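{- The following sets of binary strings of length $n$ are flip-swap languages. Flip-swap languages with respect to $1$: (i) all strings; (ii) strings with weight $\le k$; (iii) strings $\le\gamma$; (iv) strings with $\le k$ inversions with respect to $0^*1^*$; (v) strings with $\le k$ transpositions with respect to $0^*1^*$; (vi) strings $<$ their reversal; (vii) strings $\le$ their reversal (neckties); (viii) strings $<$ their complemented reversal; (ix) strings $\le$ their complemented reversal; (x) strings with forbidden $10^t$ (i.e. not containing the substring $10^t$); (xi) strings with forbidden prefix $1\gamma$; (xii) $0$-prefix normal words; (xiii) necklaces (smallest rotation); (xiv) Lyndon words; (xv) prenecklaces (smallest rotation); (xvi) pseudo-necklaces with respect to $0^*1^*$; (xvii) left factors of $k$-ary Dyck words; (xviii) feasible solutions to $0$-$1$ knapsack problems. Flip-swap languages with respect to $0$: (1) all strings; (2) strings with weight $\ge k$; (3) strings $\ge\gamma$; (4) strings with $\le k$ inversions with respect to $1^*0^*$; (5) strings with $\le k$ transpositions with respect to $1^*0^*$; (6) strings $>$ their reversal; (7) strings $\ge$ their reversal; (8) strings $>$ their complemented reversal; (9) strings $\ge$ their complemented reversal; (10) strings with forbidden $01^t$ (i.e. not containing the substring $01^t$); (11) strings with forbidden prefix $0\gamma$; (12) $1$-prefix normal words; (13) necklaces (largest rotation); (14) aperiodic necklaces (largest rotation); (15) prenecklaces (largest rotation); (16) pseudo-necklaces with respect to $1^*0^*$.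
   Context: A flip-swap language with respect to $1$ is a set $\mathbf S$ of binary strings of length $n$ such that $\mathbf S\cup\{0^n\}$ is closed under two operations (when applicable): (1) flip (complement) the leftmost $1$; (2) swap the leftmost $1$ with the bit to its right. A flip-swap language with respect to $0$ is defined similarly, with the roles of $0$ and $1$ interchanged. Here $k$ and $t$ are integer parameters and $\gamma$ is a binary string. Strings are written $\alpha=b_1b_2\cdots b_n$ and are compared lexicographically. The weight of $\alpha$ is the number of $1$s it contains. The complemented reversal of $\alpha$ is the bitwise complement of its reversal. An inversion in $\alpha$ with respect to $0^*1^*$ is an index pair $(i,j)$ such that $i<j$, $b_i=1$ and $b_j=0$; with respect to $1^*0^*$ the roles of $0$ and $1$ are interchanged. The number of transpositions of $\alpha$ with respect to another binary string $\beta$ of length $n$ is the minimum number of adjacent transpositions required to transform $\alpha$ to $\beta$; the number of transpositions with respect to $0^*1^*$ (resp. $1^*0^*$) is the number required to transform $\alpha$ into a string of the form $0^*1^*$ (resp. $1^*0^*$). A binary string is $0$-prefix normal (prefix normal with respect to $0$) if no substring of it has more $0$s than its prefix of the same length; $1$-prefix normal words are defined in the same way with $1$s in place of $0$s. A necklace is the lexicographically smallest (resp. largest) string in an equivalence class under rotation. An aperiodic necklace is a necklace that cannot be written in the form $\beta^j$ with $j\ge 2$. A Lyndon word is an aperiodic necklace when the lexicographically smallest string is used as the representative. A prenecklace is a prefix of a necklace. A block with respect to $0^*1^*$ is a maximal substring of the form $0^*1^*$. A block $B_i$ is represented by two integers $(s_i,t_i)$, its numbers of $0$s and $1$s respectively.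 A block $B_i=(s_i,t_i)$ is said to be lexicographically smaller than a block $B_j=(s_j,t_j)$, written $B_i<B_j$, if $s_i<s_j$, or $s_i=s_j$ and $t_i<t_j$. A string $\alpha=b_1b_2\cdots b_n=B_bB_{b-1}\cdots B_1$ (its decomposition into blocks) is a pseudo-necklace with respect to $0^*1^*$ if $B_b\le B_i$ for all $1\le i<b$. Pseudo-necklaces with respect to $1^*0^*$ are defined with the roles of $0$ and $1$ interchanged. A $k$-ary Dyck word is a binary string of length $tk$ with $t$ copies of $1$ and $t(k-1)$ copies of $0$ such that every prefix has at most $k-1$ copies of $0$ for every $1$. The set of length $n$ prefixes of $k$-ary Dyck words is called the left factors of $k$-ary Dyck words. The input to a $0$-$1$ knapsack problem is a capacity $W$ and a set of $n$ items, each with a weight $w_i\ge 0$ and a value $v_i$. The items are ordered so that $w_i\ge w_{i+1}$ for $1\le i\le n-1$. A subset of items is feasible if its total weight is at most $W$; the feasible solutions are represented by the incidence vectors of the feasible subsets.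
   Formalization: The block order is corrected to "s_i > s_j, or s_i = s_j and t_i < t_j" (as given, 110 flips to 010, breaking (xvi)); in (xvii) 0 and 1 are interchanged in k-ary Dyck words (as given, 11 flips to 01), and the original left factors are shown to be flip-swap with respect to 0. -}

module Defs where

open import Algebra.Bundles using (CommutativeMonoid)
import Algebra.Definitions.RawMonoid as RawMonoidDefs
open import Data.Bool.Base as Bool using (Bool; true; false; not; if_then_else_)
open import Data.Bool.Properties using (_≟_)
open import Data.Fin.Base as Fin using (Fin; toℕ)
open import Data.Fin.Properties as Fin using (_<?_)
open import Data.Integer.Base as ℤ using (ℤ; +_)
open import Data.List.Base
  using (List; []; _∷_; _++_; length; lookup; filter; map; reverse; take; replicate;
         concat; concatMap; allFin; cartesianProduct)
open import Data.List.Relation.Binary.Infix.Heterogeneous using (Infix)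
open import Data.List.Relation.Binary.Lex.Strict using (Lex-<; Lex-≤)
open import Data.List.Relation.Binary.Prefix.Heterogeneous using (Prefix)
open import Data.List.Relation.Unary.All using (All)
open import Data.List.Relation.Unary.Linked using (Linked)
open import Data.Nat.Base as ℕ using (ℕ; zero; suc; _+_; _*_; _∸_; _≤_; _<_)
open import Data.Product.Base using (_×_; _,_; ∃; ∃₂; ∃-syntax)
open import Data.Sum.Base using (_⊎_)
open import Data.Vec.Base as Vec using (Vec; []; _∷_; toList)
open import Data.Vec.Functional using (Vector)
open import Level using (Level; _⊔_) renaming (suc to lsuc)
open import Relation.Binary.Core using (Rel; _Preserves₂_⟶_⟶_)
open import Relation.Binary.Definitions using (_Respects_)
open import Relation.Binary.PropositionalEquality using (_≡_; _≢_)
open import Relation.Binary.Structures using (IsPartialOrder)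
open import Relation.Nullary using (¬_; Dec; _×-dec_)
open import Relation.Unary using (Pred; _∪_; ｛_｝; _⊢_)

private
  variable
    n : ℕ
    a b : Bool
    u v : Vec Bool n
    α β γ : List Bool
    ℓ : Level

pattern 𝟘 = false
pattern 𝟙 = true

data FlipFirst (a : Bool) : Rel (Vec Bool n) Level.zero where
  here  : FlipFirst a (a ∷ u) (not a ∷ u)
  there : b ≢ a → FlipFirst a u v → FlipFirst a (b ∷ u) (b ∷ v)

-- Empty when the leftmost a is the last bit, as it then has no right neighbour.
data SwapFirst (a : Bool) : Rel (Vec Bool n) Level.zero where
  here  : SwapFirst a (a ∷ b ∷ u) (b ∷ a ∷ u)
  there : b ≢ a → SwapFirst a u v → SwapFirst a (b ∷ u) (b ∷ v)

FlipSwap : Bool → Pred (Vec Bool n) ℓ → Set ℓ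
FlipSwap {n = n} a S = (S̄ Respects FlipFirst a) × (S̄ Respects SwapFirst a)
  where S̄ = S ∪ ｛ Vec.replicate n (not a) ｝

ofLength : (n : ℕ) → Pred (List Bool) ℓ → Pred (Vec Bool n) ℓ
ofLength n P = toList ⊢ P

infix 4 _<ˡ_ _≤ˡ_

_<ˡ_ : Rel (List Bool) _
_<ˡ_ = Lex-< _≡_ Bool._<_

_≤ˡ_ : Rel (List Bool) _
_≤ˡ_ = Lex-≤ _≡_ Bool._<_

IsPrefix : Rel (List Bool) _
IsPrefix = Prefix _≡_

IsSubstring : Rel (List Bool) _
IsSubstring = Infix _≡_

PrefixOf : Pred (List Bool) ℓ → Pred (List Bool) ℓ
PrefixOf P α = ∃[ β ] P β × IsPrefix α β

count : Bool → List Bool → ℕ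
count a α = length (filter (a ≟_) α)

weight : List Bool → ℕ
weight = count 𝟙

complementedReversal : List Bool → List Bool
complementedReversal α = map not (reverse α)

-- For inversions, transpositions and blocks, a = 𝟙 means with respect to 0*1*
-- and a = 𝟘 means with respect to 1*0*.

Inversion : Bool → (α : List Bool) → Pred (Fin (length α) × Fin (length α)) _
Inversion a α (i , j) = i Fin.< j × lookup α i ≡ a × lookup α j ≡ not a

inversion? : ∀ a α p → Dec (Inversion a α p)
inversion? a α (i , j) = (i <? j) ×-dec (lookup α i ≟ a) ×-dec (lookup α j ≟ not a)

inversions : Bool → List Bool → ℕ
inversions a α = length (filter (inversion? a α) (cartesianProduct indices indices))
  where indices = allFin (length α)

data AdjacentTransposition : Rel (List Bool) Level.zero where
  here  : AdjacentTransposition (a ∷ b ∷ α) (b ∷ a ∷ α)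
  there : AdjacentTransposition α β → AdjacentTransposition (a ∷ α) (a ∷ β)

data Transforms : ℕ → Rel (List Bool) Level.zero where
  done : Transforms 0 α α
  step : ∀ {m} → AdjacentTransposition α β → Transforms m β γ → Transforms (suc m) α γ

runs : Bool → ℕ × ℕ → List Bool
runs a (s , t) = replicate s (not a) ++ replicate t a

SortedForm : Bool → Pred (List Bool) _
SortedForm a α = ∃ λ st → α ≡ runs a st

-- m is the least number of adjacent transpositions taking α into P.
IsTranspositionNumber : Pred (List Bool) ℓ → List Bool → ℕ → Set ℓ
IsTranspositionNumber P α m =
  (∃[ β ] P β × Transforms m α β) ×
  (∀ {m′ β} → P β → Transforms m′ α β → m ≤ m′)

TranspositionsAtMost : ℤ → Bool → Pred (List Bool) _
TranspositionsAtMost k a α = ∃[ m ] IsTranspositionNumber (SortedForm a) α m × + m ℤ.≤ k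

PrefixNormal : Bool → Pred (List Bool) _
PrefixNormal a α = ∀ {β} → IsSubstring β α → count a β ≤ count a (take (length β) α)

Rotation : Rel (List Bool) _
Rotation α β = ∃₂ λ γ δ → α ≡ γ ++ δ × β ≡ δ ++ γ

SmallestNecklace : Pred (List Bool) _
SmallestNecklace α = ∀ {β} → Rotation α β → α ≤ˡ β

LargestNecklace : Pred (List Bool) _
LargestNecklace α = ∀ {β} → Rotation α β → β ≤ˡ α

Aperiodic : Pred (List Bool) _
Aperiodic α = ¬ (∃₂ λ β j → 2 ≤ j × α ≡ concat (replicate j β))

-- The block (s , t) is the string runs a (s , t).
Block : Set
Block = ℕ × ℕ

NonEmpty : Pred Block _
NonEmpty (s , t) = 0 < s + t

-- Two consecutive blocks are both maximal exactly when the left one ends in a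
-- and the right one begins with not a.
MaximalAt : Rel Block _
MaximalAt (_ , t) (s′ , _) = 0 < t × 0 < s′

record IsBlockDecomposition (a : Bool) (α : List Bool) (Bs : List Block) : Set where
  field
    concatenates : α ≡ concatMap (runs a) Bs
    nonEmpty     : All NonEmpty Bs
    maximal      : Linked MaximalAt Bs

infix 4 _<ᴮ_ _≤ᴮ_

-- For a = 𝟙 this is the lexicographic order of the strings 0ˢ1ᵗ (with s, t > 0):
-- the block with more 0s is the smaller one, as in the lexicographically
-- smallest rotation.  Ordering blocks by s < s′ instead would make the
-- flip-swap property fail: 110, with blocks (0 , 2) and (1 , 0), flips to 010,
-- with blocks (1 , 1) and (1 , 0).
_<ᴮ_ : Rel Block _
(s , t) <ᴮ (s′ , t′) = s′ < s ⊎ (s ≡ s′ × t < t′)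

_≤ᴮ_ : Rel Block _
B ≤ᴮ B′ = B <ᴮ B′ ⊎ B ≡ B′

PseudoNecklace : Bool → Pred (List Bool) _
PseudoNecklace a α =
  ∃₂ λ B Bs → IsBlockDecomposition a α (B ∷ Bs) × All (B ≤ᴮ_) Bs

-- The usual k-ary Dyck words have a = 𝟙.  Their left factors are a flip-swap
-- language with respect to 0, but not with respect to 1: every nonempty one
-- starts with 1, and flipping that 1 in 11 gives 01.  With respect to 1 it is
-- the left factors for a = 𝟘 that are closed.
record DyckWord (a : Bool) (k : ℕ) (α : List Bool) : Set where
  field
    t          : ℕ
    length≡    : length α ≡ t * k
    count≡     : count a α ≡ t
    countNot≡  : count (not a) α ≡ t * (k ∸ 1)
    prefixes   : ∀ {β} → IsPrefix β α → count (not a) β ≤ (k ∸ 1) * count a β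

-- Knapsack weights and values are taken in an arbitrary partially ordered
-- commutative monoid, which covers ℕ, ℤ, ℚ and the reals under addition.
record CommutativePomonoid c ℓ₁ ℓ₂ : Set (lsuc (c ⊔ ℓ₁ ⊔ ℓ₂)) where
  field
    commutativeMonoid : CommutativeMonoid c ℓ₁
  open CommutativeMonoid commutativeMonoid public
  infix 4 _≼_
  field
    _≼_            : Rel Carrier ℓ₂
    isPartialOrder : IsPartialOrder _≈_ _≼_
    ∙-mono         : _∙_ Preserves₂ _≼_ ⟶ _≼_ ⟶ _≼_

module _ {c ℓ₁ ℓ₂} (M : CommutativePomonoid c ℓ₁ ℓ₂) where
  open CommutativePomonoid M
  open RawMonoidDefs rawMonoid using (sum)

  record Knapsack (n : ℕ) : Set (c ⊔ ℓ₂) where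
    field
      capacity    : Carrier
      itemWeight  : Vector Carrier n
      itemValue   : Vector Carrier n
      nonNegative : ∀ i → ε ≼ itemWeight i
      decreasing  : ∀ {i j} → toℕ j ≡ suc (toℕ i) → itemWeight j ≼ itemWeight i

  Feasible : Knapsack n → Pred (Vec Bool n) ℓ₂
  Feasible K α = sum (λ i → if Vec.lookup α i then itemWeight i else ε) ≼ capacity
    where open Knapsack K

{-# OPTIONS --safe #-}

-- With a in the role of 1 and not a in the role of 0, a flip or an effective swap takes 0ᵖ1x to
-- 0ᵖ⁺¹y, where y = x for a flip, and x = 0u, y = 1u for a swap.  Hence the position of the leftmost
-- 1 (the offset) strictly grows.  Between strings of equal length a larger offset means smaller in
-- lexicographic order, so for necklaces and reversals it suffices to compare offsets: when α is at
-- most its (complemented) reversal, or a necklace, the offset p of α bounds the offsets of the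
-- competing strings, and that bound survives the step, except when the target is 0ⁿ or when
-- α = 0ᵖ101ᵖ is its own complemented reversal.  In particular a step from a necklace leads to a
-- Lyndon word or to 0ⁿ.  The transposition number of a string is its number of inversions; prefix
-- normality is subadditivity of the prefix counts; and the left factors of Dyck words are the
-- strings whose prefixes satisfy the ballot condition.

module Submission where

import Algebra.Definitions.RawMonoid as RawMonoidDefs
open import Data.Bool.Base using (Bool; not; if_then_else_; f<t)
open import Data.Bool.Properties as Bool using (_≟_; ¬-not; not-involutive; not-¬)
open import Data.Fin.Base using (Fin; zero; suc; toℕ)
open import Data.Integer.Base as ℤ using (ℤ; +_)
import Data.Integer.Properties as ℤ
open import Data.List.Base
  using (List; []; _∷_; [_]; _++_; length; reverse; replicate; map; take; drop; filter; lookup;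
         concat; concatMap; allFin; tabulate; cartesianProduct)
open import Data.List.Properties
open import Data.List.Relation.Binary.Infix.Heterogeneous using (here; there; _++ⁱ_)
open import Data.List.Relation.Binary.Lex.Strict as Lex using (halt; this; next; <-irreflexive)
open import Data.List.Relation.Binary.Permutation.Propositional
  using (_↭_; prep; swap; ↭-refl; ↭-trans)
open import Data.List.Relation.Binary.Permutation.Propositional.Properties
  using (↭-length; filter-↭)
import Data.List.Relation.Binary.Pointwise as Pointwise
open import Data.List.Relation.Binary.Prefix.Heterogeneous using ([]; _∷_)
open import Data.List.Relation.Unary.All as All using (All; []; _∷_)
import Data.List.Relation.Unary.All.Properties as All
open import Data.List.Relation.Unary.Linked using (Linked; [-]; _∷_)
open import Data.Nat.Base
open import Data.Nat.Properties hiding (_≟_)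
open import Data.Product.Base using (_×_; _,_; ∃₂; ∃-syntax; proj₁)
open import Data.Sum.Base as Sum using (_⊎_; inj₁; inj₂)
open import Data.Vec.Base as Vec using (Vec; []; _∷_; toList)
open import Data.Vec.Functional using (Vector)
open import Function.Base using (_∘_; id)
open import Level using (Level; 0ℓ)
open import Relation.Binary.Core using (Rel)
open import Relation.Binary.PropositionalEquality
  using (_≡_; _≢_; refl; sym; trans; cong; cong₂; subst; subst₂; isEquivalence; module ≡-Reasoning)
open import Relation.Binary.Structures using (IsPartialOrder)
open import Relation.Nullary using (¬_; does; yes; no; contradiction)
open import Relation.Unary using (Pred; Decidable; U; _∩_; _∪_; ｛_｝)
open import Defs

private
  variable
    n : ℕ
    a b : Bool
    x y α β γ δ : List Bool
    ℓ : Level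

-- Flips and swaps as steps on lists

data Tails (a : Bool) : Rel (List Bool) 0ℓ where
  flip : Tails a x x
  swap : Tails a (not a ∷ x) (a ∷ x)

-- Swaps of two equal letters are left out.
data Step (a : Bool) : Rel (List Bool) 0ℓ where
  step : ∀ p → Tails a x y →
         Step a (replicate p (not a) ++ a ∷ x) (replicate p (not a) ++ not a ∷ y)

Zeros : Bool → Pred (List Bool) _
Zeros a = All (_≡ not a)

-- The alternative `Zeros a β` stands for the extra string that `FlipSwap` adjoins to the language.
-- As a source that string gives no case, because no step leaves it (`Zeros⇒¬Step`).
Closed : Bool → Pred (List Bool) ℓ → Set ℓ
Closed a P = ∀ {α β} → Step a α β → P α → P β ⊎ Zeros a β

Step-∷ : Step a α β → Step a (not a ∷ α) (not a ∷ β)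
Step-∷ (step p t) = step (suc p) t

FlipFirst⇒Step : {u v : Vec Bool n} → FlipFirst a u v → Step a (toList u) (toList v)
FlipFirst⇒Step here = step 0 flip
FlipFirst⇒Step (there b≢a f) rewrite ¬-not b≢a = Step-∷ (FlipFirst⇒Step f)

SwapFirst⇒Step : {u v : Vec Bool n} → SwapFirst a u v → u ≡ v ⊎ Step a (toList u) (toList v)
SwapFirst⇒Step {a = a} (here {b = b}) with b ≟ a
... | yes refl = inj₁ refl
... | no b≢a rewrite ¬-not b≢a = inj₂ (step 0 swap)
SwapFirst⇒Step (there b≢a f) rewrite ¬-not b≢a =
  Sum.map (cong (_ ∷_)) Step-∷ (SwapFirst⇒Step f)

Zeros⇒replicate : (v : Vec Bool n) → Zeros a (toList v) → Vec.replicate n (not a) ≡ v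
Zeros⇒replicate []      []         = refl
Zeros⇒replicate (_ ∷ v) (refl ∷ z) = cong (_ ∷_) (Zeros⇒replicate v z)

replicate⇒Zeros : (n : ℕ) → Zeros a (toList (Vec.replicate n (not a)))
replicate⇒Zeros zero    = []
replicate⇒Zeros (suc n) = refl ∷ replicate⇒Zeros n

Zeros⇒¬Step : Zeros a α → ¬ Step a α β
Zeros⇒¬Step z (step p _) with All.++⁻ʳ (replicate p _) z
... | a≡not-a ∷ _ = not-¬ refl a≡not-a

-- A swap of two equal letters fixes the string and is settled by `stay`; every other operation is a
-- `Step`.
Closed⇒FlipSwap : {P : Pred (List Bool) ℓ} → Closed a P → (n : ℕ) → FlipSwap a (ofLength n P)
Closed⇒FlipSwap {a = a} {P} closed n =
  (λ f → advance (FlipFirst⇒Step f)) , λ f → stay (SwapFirst⇒Step f)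
  where
  S̄ : Pred (Vec Bool n) _
  S̄ = ofLength n P ∪ ｛ Vec.replicate n (not a) ｝

  advance : ∀ {u v} → Step a (toList u) (toList v) → S̄ u → S̄ v
  advance {v = v} s (inj₁ Pu)   = Sum.map₂ (Zeros⇒replicate v) (closed s Pu)
  advance         s (inj₂ refl) = contradiction s (Zeros⇒¬Step (replicate⇒Zeros n))

  stay : ∀ {u v} → u ≡ v ⊎ Step a (toList u) (toList v) → S̄ u → S̄ v
  stay (inj₁ refl) = id
  stay (inj₂ s)    = advance s

-- Position of the leftmost a, or the length of the string if there is none.
offset : Bool → List Bool → ℕ
offset a []      = 0
offset a (b ∷ α) = if does (b ≟ a) then 0 else suc (offset a α)

offset-here : ∀ a α → offset a (a ∷ α) ≡ 0
offset-here 𝟘 α = refl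
offset-here 𝟙 α = refl

offset-there : ∀ a α → offset a (not a ∷ α) ≡ suc (offset a α)
offset-there 𝟘 α = refl
offset-there 𝟙 α = refl

offset-Zeros : Zeros a α → ∀ β → offset a (α ++ β) ≡ length α + offset a β
offset-Zeros []         β = refl
offset-Zeros {a} (_∷_ {xs = α} refl z) β =
  trans (offset-there a (α ++ β)) (cong suc (offset-Zeros z β))

offset-Zeros-∷ : Zeros a α → ∀ β → offset a (α ++ a ∷ β) ≡ length α
offset-Zeros-∷ {a} z β rewrite offset-Zeros z (a ∷ β) | offset-here a β = +-identityʳ _

offset-replicate : ∀ a p α → offset a (replicate p (not a) ++ α) ≡ p + offset a α
offset-replicate a p α =
  trans (offset-Zeros (All.replicate⁺ p refl) α) (cong (_+ _) (length-replicate p))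

-- The offset is settled by the first `a`: once one occurs in `α`, nothing appended can matter.
Zeros⊎offset-++ : ∀ a α → Zeros a α ⊎ (∀ β → offset a (α ++ β) ≡ offset a α)
Zeros⊎offset-++ a [] = inj₁ []
Zeros⊎offset-++ a (b ∷ α) with b ≟ a
... | yes refl = inj₂ λ _ → refl
... | no b≢a   = Sum.map (¬-not b≢a ∷_) (λ eq β → cong suc (eq β)) (Zeros⊎offset-++ a α)

-- The offsets can differ only if `α` has no `a`, and then the left string has its first `a` right
-- after `α`, the earliest place left.
offset-++-here : ∀ α → offset a (α ++ a ∷ β) ≤ offset a (α ++ γ)
offset-++-here {a} {β} [] rewrite offset-here a β = z≤n
offset-++-here {a} (b ∷ α) with b ≟ a
... | yes _ = z≤n
... | no  _ = s≤s (offset-++-here α)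

-- Lexicographic order and offsets

-- Interchanging the letters reverses lexicographic order between strings of equal length, so the
-- order is turned around for `a = 𝟘`. Either way the smaller string has `not a` at the first
-- difference, and one argument serves both halves of the theorem.
Below AtMost : Bool → Rel (List Bool) _
Below 𝟙 α β = α <ˡ β
Below 𝟘 α β = β <ˡ α
AtMost 𝟙 α β = α ≤ˡ β
AtMost 𝟘 α β = β ≤ˡ α

<ˡ⇒≤ˡ : α <ˡ β → α ≤ˡ β
<ˡ⇒≤ˡ halt           = halt
<ˡ⇒≤ˡ (this a<b)     = this a<b
<ˡ⇒≤ˡ (next a≡b α<β) = next a≡b (<ˡ⇒≤ˡ α<β)

Below⇒AtMost : ∀ a → Below a α β → AtMost a α β
Below⇒AtMost 𝟙 = <ˡ⇒≤ˡ
Below⇒AtMost 𝟘 = <ˡ⇒≤ˡ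

Below-irrefl : ∀ a → ¬ Below a α α
Below-irrefl 𝟙 = <-irreflexive Bool.<-irrefl (Pointwise.refl refl)
Below-irrefl 𝟘 = <-irreflexive Bool.<-irrefl (Pointwise.refl refl)

AtMost-reflexive : ∀ a → α ≡ β → AtMost a α β
AtMost-reflexive 𝟙 refl = Lex.≤-reflexive _≡_ _ (Pointwise.refl refl)
AtMost-reflexive 𝟘 refl = Lex.≤-reflexive _≡_ _ (Pointwise.refl refl)

AtMost-trans : ∀ a → AtMost a α β → AtMost a β γ → AtMost a α γ
AtMost-trans 𝟙 p q = Lex.≤-transitive isEquivalence Bool.<-resp₂-≡ Bool.<-trans p q
AtMost-trans 𝟘 p q = Lex.≤-transitive isEquivalence Bool.<-resp₂-≡ Bool.<-trans q p

-- Before the offset of `β` both strings consist of `not a`; at it `β` has `a` and `α` still has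
-- `not a`. Equal length ensures that `β` contains an `a`: otherwise its offset would be its length,
-- which the offset of `α` cannot exceed.
offset⇒Below : ∀ a α β → length α ≡ length β → offset a β < offset a α → Below a α β
offset⇒Below 𝟙 (𝟘 ∷ α) (𝟘 ∷ β) eq lt = next refl (offset⇒Below 𝟙 α β (suc-injective eq) (s≤s⁻¹ lt))
offset⇒Below 𝟙 (𝟘 ∷ α) (𝟙 ∷ β) eq lt = this f<t
offset⇒Below 𝟘 (𝟙 ∷ α) (𝟙 ∷ β) eq lt = next refl (offset⇒Below 𝟘 α β (suc-injective eq) (s≤s⁻¹ lt))
offset⇒Below 𝟘 (𝟙 ∷ α) (𝟘 ∷ β) eq lt = this f<t

AtMost⇒offset : ∀ a α β → length α ≡ length β → AtMost a α β → offset a β ≤ offset a α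
AtMost⇒offset 𝟙 []      []      eq le             = z≤n
AtMost⇒offset 𝟙 (𝟘 ∷ α) (𝟙 ∷ β) eq le             = z≤n
AtMost⇒offset 𝟙 (𝟘 ∷ α) (𝟘 ∷ β) eq (next refl le) = s≤s (AtMost⇒offset 𝟙 α β (suc-injective eq) le)
AtMost⇒offset 𝟙 (𝟙 ∷ α) (𝟙 ∷ β) eq le             = z≤n
AtMost⇒offset 𝟙 (𝟙 ∷ α) (𝟘 ∷ β) eq (this ())
AtMost⇒offset 𝟙 (𝟙 ∷ α) (𝟘 ∷ β) eq (next () _)
AtMost⇒offset 𝟘 []      []      eq le             = z≤n
AtMost⇒offset 𝟘 (𝟙 ∷ α) (𝟘 ∷ β) eq le             = z≤n
AtMost⇒offset 𝟘 (𝟙 ∷ α) (𝟙 ∷ β) eq (next refl le) = s≤s (AtMost⇒offset 𝟘 α β (suc-injective eq) le)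
AtMost⇒offset 𝟘 (𝟘 ∷ α) (𝟘 ∷ β) eq le             = z≤n
AtMost⇒offset 𝟘 (𝟘 ∷ α) (𝟙 ∷ β) eq (this ())
AtMost⇒offset 𝟘 (𝟘 ∷ α) (𝟙 ∷ β) eq (next () _)

offset-source : ∀ a p x → offset a (replicate p (not a) ++ a ∷ x) ≡ p
offset-source a p x rewrite offset-replicate a p (a ∷ x) | offset-here a x = +-identityʳ p

offset-target : ∀ a p y → offset a (replicate p (not a) ++ not a ∷ y) ≡ suc p + offset a y
offset-target a p y rewrite offset-replicate a p (not a ∷ y) | offset-there a y = +-suc p _

length-Tails : Tails a x y → length x ≡ length y
length-Tails flip = refl
length-Tails swap = refl

length-Step : Step a α β → length α ≡ length β
length-Step (step zero    t) = cong suc (length-Tails t)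
length-Step (step (suc p) t) = cong suc (length-Step (step p t))

Step⇒offset< : Step a α β → offset a α < offset a β
Step⇒offset< {a} (step {x} {y} p _)
  rewrite offset-source a p x | offset-target a p y = s≤s (m≤m+n p _)

Step⇒Below : Step a α β → Below a β α
Step⇒Below {a} {α} {β} s = offset⇒Below a β α (sym (length-Step s)) (Step⇒offset< s)

downward-closed : ∀ a γ → Closed a (λ α → AtMost a α γ)
downward-closed a γ s α≤γ = inj₁ (AtMost-trans a (Below⇒AtMost a (Step⇒Below s)) α≤γ)

U-closed : ∀ a → Closed a U
U-closed _ _ _ = inj₁ _

-- Reversal

reverse-++-∷ : ∀ α b (β : List Bool) → reverse (α ++ b ∷ β) ≡ reverse β ++ b ∷ reverse α
reverse-++-∷ α b β
  rewrite reverse-++ α (b ∷ β) | unfold-reverse b β = ++-assoc (reverse β) [ b ] (reverse α)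

Zeros-reverse : Zeros a (reverse α) → Zeros a α
Zeros-reverse {α = α} z = subst (Zeros _) (reverse-involutive α) (Zeros-reverse⁺ (reverse α) z)
  where
  Zeros-reverse⁺ : ∀ α → Zeros a α → Zeros a (reverse α)
  Zeros-reverse⁺ []      []      = []
  Zeros-reverse⁺ (b ∷ α) (p ∷ z) =
    subst (Zeros _) (sym (unfold-reverse b α)) (All.++⁺ (Zeros-reverse⁺ α z) (p ∷ []))

Zeros-target : ∀ p → Zeros a y → Zeros a (replicate p (not a) ++ not a ∷ y)
Zeros-target p z = All.++⁺ (All.replicate⁺ p refl) (refl ∷ z)

-- In the reversal the step acts behind `reverse x`. A flip leaves the offset alone if `x` contains
-- `a`, and otherwise removes the only `a`. A swap moves an `a` one place towards the front of the
-- reversal.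
offset-reverse : Step a α β → offset a (reverse α) ≤ offset a α →
                 offset a (reverse β) ≤ offset a α ⊎ Zeros a β
offset-reverse {a} (step {x = x} p flip) le
  rewrite reverse-++-∷ (replicate p (not a)) a x
        | reverse-++-∷ (replicate p (not a)) (not a) x
        | offset-source a p x
  with Zeros⊎offset-++ a (reverse x)
... | inj₁ z  = inj₂ (Zeros-target p (Zeros-reverse z))
... | inj₂ eq = inj₁ (subst (_≤ p) (trans (eq _) (sym (eq _))) le)
offset-reverse {a} (step p (swap {x = x})) le
  rewrite reverse-++-∷ (replicate p (not a)) a (not a ∷ x)
        | reverse-++-∷ (replicate p (not a)) (not a) (a ∷ x)
        | unfold-reverse (not a) x | unfold-reverse a x
        | ++-assoc (reverse x) [ not a ] (a ∷ reverse (replicate p (not a)))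
        | ++-assoc (reverse x) [ a ] (not a ∷ reverse (replicate p (not a)))
  = inj₁ (≤-trans (offset-++-here (reverse x)) le)

-- The offset of `reverse β` is at most that of `α`, which is less than that of `β`. The conclusion
-- is thus strict even if `α` is a palindrome, and serves the strict and the weak language alike.
Step⇒Below-reverse : Step a α β → AtMost a α (reverse α) → Below a β (reverse β) ⊎ Zeros a β
Step⇒Below-reverse {a} {α} {β} s le =
  Sum.map₁
    (λ le′ → offset⇒Below a β (reverse β) (sym (length-reverse β)) (≤-<-trans le′ (Step⇒offset< s)))
    (offset-reverse s (AtMost⇒offset a α (reverse α) (sym (length-reverse α)) le))

Below-reverse-closed : ∀ a → Closed a (λ α → Below a α (reverse α))
Below-reverse-closed a s lt = Step⇒Below-reverse s (Below⇒AtMost a lt)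

AtMost-reverse-closed : ∀ a → Closed a (λ α → AtMost a α (reverse α))
AtMost-reverse-closed a s le = Sum.map₁ (Below⇒AtMost a) (Step⇒Below-reverse s le)

-- Complemented reversal

complementedReversal-++-∷ : ∀ α b β →
  complementedReversal (α ++ b ∷ β) ≡ complementedReversal β ++ not b ∷ complementedReversal α
complementedReversal-++-∷ α b β
  rewrite reverse-++-∷ α b β = map-++ not (reverse β) (b ∷ reverse α)

complementedReversal-∷ : ∀ b α → complementedReversal (b ∷ α) ≡ complementedReversal α ++ [ not b ]
complementedReversal-∷ b α = complementedReversal-++-∷ [] b α

complementedReversal-involutive : ∀ α → complementedReversal (complementedReversal α) ≡ α
complementedReversal-involutive [] = refl
complementedReversal-involutive (b ∷ α) = begin
  complementedReversal (complementedReversal (b ∷ α))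
    ≡⟨ cong complementedReversal (complementedReversal-∷ b α) ⟩
  complementedReversal (complementedReversal α ++ [ not b ])
    ≡⟨ complementedReversal-++-∷ (complementedReversal α) (not b) [] ⟩
  not (not b) ∷ complementedReversal (complementedReversal α)
    ≡⟨ cong₂ _∷_ (not-involutive b) (complementedReversal-involutive α) ⟩
  b ∷ α ∎
  where open ≡-Reasoning

length-complementedReversal : ∀ α → length (complementedReversal α) ≡ length α
length-complementedReversal α = trans (length-map not (reverse α)) (length-reverse α)

Zeros⇒≡replicate : Zeros a α → α ≡ replicate (length α) (not a)
Zeros⇒≡replicate []         = refl
Zeros⇒≡replicate (refl ∷ z) = cong (_ ∷_) (Zeros⇒≡replicate z)

complementedReversal-source : ∀ a p x → let C = complementedReversal in
  C (replicate p (not a) ++ a ∷ x) ≡ C x ++ not a ∷ C (replicate p (not a))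
complementedReversal-source a p x = complementedReversal-++-∷ (replicate p (not a)) a x

complementedReversal-target : ∀ a p y → let C = complementedReversal in
  C (replicate p (not a) ++ not a ∷ y) ≡ C y ++ a ∷ C (replicate p (not a))
complementedReversal-target a p y
  rewrite complementedReversal-++-∷ (replicate p (not a)) (not a) y | not-involutive a = refl

-- The second alternative is α = 0ᵖ101ᵖ and β = 0ᵖ⁺¹1ᵖ⁺¹.
offset-complementedReversal : let C = complementedReversal in
  Step a α β → offset a (C α) ≤ offset a α → offset a (C β) ≤ offset a α ⊎ (α ≡ C α × β ≡ C β)
offset-complementedReversal {a} (step {x = x} p flip) le
  rewrite complementedReversal-source a p x | complementedReversal-target a p x
  -- Complementing makes the flip write an `a` right after `complementedReversal x`, so the offset
  -- cannot grow.
  = inj₁ (≤-trans (offset-++-here (complementedReversal x)) le)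
offset-complementedReversal {a} (step p (swap {x = x})) le
  rewrite complementedReversal-source a p (not a ∷ x) | complementedReversal-target a p (a ∷ x)
        | complementedReversal-∷ (not a) x | complementedReversal-∷ a x
        | not-involutive a | offset-source a p (not a ∷ x)
        | ++-assoc (complementedReversal x) [ a ] (not a ∷ complementedReversal (replicate p (not a)))
        | ++-assoc (complementedReversal x) [ not a ] (a ∷ complementedReversal (replicate p (not a)))
  with Zeros⊎offset-++ a (complementedReversal x)
... | inj₂ eq = inj₁ (subst (_≤ p) (trans (eq _) (sym (eq _))) le)
-- Now `complementedReversal x` has no `a`, so its length is the offset on the source side, hence at
-- most `p`. The swap raises this offset by one, which exceeds `p` only in the case of equality.
... | inj₁ z with m≤n⇒m<n∨m≡n (subst (_≤ p) (offset-Zeros-∷ z _) le)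
...   | inj₁ q<p = inj₁ (subst (_≤ p) (sym offset≡) q<p)
  where
  offset≡ : offset a (complementedReversal x ++ not a ∷ a ∷ complementedReversal (replicate p (not a)))
          ≡ suc (length (complementedReversal x))
  offset≡ = begin
    offset a (complementedReversal x ++ not a ∷ a ∷ complementedReversal (replicate p (not a)))
      ≡⟨ cong (offset a) (++-assoc (complementedReversal x) [ not a ] _) ⟨
    offset a ((complementedReversal x ++ [ not a ]) ++ a ∷ complementedReversal (replicate p (not a)))
      ≡⟨ offset-Zeros-∷ (All.++⁺ z (refl ∷ [])) _ ⟩
    length (complementedReversal x ++ [ not a ])
      ≡⟨ trans (length-++ (complementedReversal x)) (+-comm _ 1) ⟩
    suc (length (complementedReversal x)) ∎
    where open ≡-Reasoning
-- Equality forces `complementedReversal x` to be `0ᵖ`, so by involutivity `x` is `1ᵖ`; the two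
-- middle letters, `10` or `01`, are their own complemented reversal.
...   | inj₂ q≡p = inj₂ (with-tails (a ∷ [ not a ]) , with-tails (not a ∷ [ a ]))
  where
  Cx≡ : complementedReversal x ≡ replicate p (not a)
  Cx≡ = subst (λ m → complementedReversal x ≡ replicate m (not a)) q≡p (Zeros⇒≡replicate z)

  with-tails : ∀ γ → replicate p (not a) ++ γ ++ x
             ≡ complementedReversal x ++ γ ++ complementedReversal (replicate p (not a))
  with-tails γ = cong₂ (λ μ ν → μ ++ γ ++ ν) (sym Cx≡)
    (trans (sym (complementedReversal-involutive x)) (cong complementedReversal Cx≡))

Step⇒Below-complementedReversal : let C = complementedReversal in
  Step a α β → AtMost a α (C α) → Below a β (C β) ⊎ (α ≡ C α × β ≡ C β)
Step⇒Below-complementedReversal {a} {α} {β} s le =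
  Sum.map₁
    (λ le′ → offset⇒Below a β _ (sym (length-complementedReversal β)) (≤-<-trans le′ (Step⇒offset< s)))
    (offset-complementedReversal s (AtMost⇒offset a α _ (sym (length-complementedReversal α)) le))

Below-complementedReversal-closed : ∀ a → Closed a (λ α → Below a α (complementedReversal α))
Below-complementedReversal-closed a {α} {β} s lt
  with Step⇒Below-complementedReversal s (Below⇒AtMost a lt)
... | inj₁ lt′      = inj₁ lt′
... | inj₂ (eq , _) = contradiction (subst (Below a α) (sym eq) lt) (Below-irrefl a)

AtMost-complementedReversal-closed : ∀ a → Closed a (λ α → AtMost a α (complementedReversal α))
AtMost-complementedReversal-closed a s le with Step⇒Below-complementedReversal s le
... | inj₁ lt       = inj₁ (Below⇒AtMost a lt)
... | inj₂ (_ , eq) = inj₁ (AtMost-reflexive a eq)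

-- Forbidden strings

substring-dropZeros : ∀ p → IsSubstring (a ∷ γ) (replicate p (not a) ++ α) → IsSubstring (a ∷ γ) α
substring-dropZeros zero    s               = s
substring-dropZeros (suc p) (here (eq ∷ _)) = contradiction eq (not-¬ refl)
substring-dropZeros (suc p) (there s)       = substring-dropZeros p s

-- The only occurrence that has to be changed starts at the swapped `a`. In the source that `a` is
-- followed by one more `not a`, so the run of `t` letters starts one place earlier and its last
-- letter is dropped.
substring-Tails : ∀ {t} → Tails a x y →
  IsSubstring (a ∷ replicate t (not a)) y → IsSubstring (a ∷ replicate t (not a)) (a ∷ x)
substring-Tails flip s = there s
substring-Tails {t = zero}  swap (here _)       = here (refl ∷ [])
substring-Tails {t = suc t} swap (here (_ ∷ p)) = here (refl ∷ refl ∷ dropLast t p)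
  where
  dropLast : ∀ t {b α} → IsPrefix (replicate (suc t) b) α → IsPrefix (replicate t b) α
  dropLast zero    _        = []
  dropLast (suc t) (eq ∷ p) = eq ∷ dropLast t p
substring-Tails swap (there s) = there (there s)

forbidden-substring-closed : ∀ a t → Closed a (λ α → ¬ IsSubstring (a ∷ replicate t (not a)) α)
forbidden-substring-closed a t (step {y = y} p tails) ¬s = inj₁ λ s →
  ¬s (replicate p (not a) ++ⁱ substring-Tails tails (substring-dropZeros 1 (substring-dropZeros p s)))

-- The target of a step always begins with `not a`.
forbidden-prefix-closed : ∀ a γ → Closed a (λ α → ¬ IsPrefix (a ∷ γ) α)
forbidden-prefix-closed a γ (step zero    _) _ = inj₁ λ { (eq ∷ _) → not-¬ refl eq }
forbidden-prefix-closed a γ (step (suc _) _) _ = inj₁ λ { (eq ∷ _) → not-¬ refl eq }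

-- Levi's lemma. It locates the cut of a rotation relative to the leading run, and the end of a
-- prefix relative to the start of the padding of a Dyck word.
Levi : ∀ (α : List Bool) → α ++ β ≡ γ ++ δ →
       (∃[ ζ ] α ≡ γ ++ ζ × δ ≡ ζ ++ β) ⊎ (∃[ ζ ] γ ≡ α ++ ζ × β ≡ ζ ++ δ)
Levi {γ = γ}     []      eq = inj₂ (γ , refl , eq)
Levi {γ = []}    (b ∷ α) eq = inj₁ (b ∷ α , refl , sym eq)
Levi {γ = c ∷ γ} (b ∷ α) eq with ∷-injective eq
... | refl , eq′ = Sum.map
  (λ (ζ , p , q) → ζ , cong (c ∷_) p , q) (λ (ζ , p , q) → ζ , cong (c ∷_) p , q) (Levi α eq′)

-- Necklaces

-- Unfolds to `SmallestNecklace` for `𝟙` and to `LargestNecklace` for `𝟘`.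
Necklace : Bool → Pred (List Bool) _
Necklace a α = ∀ {β} → Rotation α β → AtMost a α β

-- Strictness against all proper rotations yields both the necklace property and aperiodicity.
Lyndon : Bool → Pred (List Bool) _
Lyndon a α = ∀ γ δ → α ≡ γ ++ δ → γ ≢ [] → δ ≢ [] → Below a α (δ ++ γ)

Lyndon⇒Necklace : Lyndon a α → Necklace a α
Lyndon⇒Necklace {a} lyndon ([] , δ , eq , eq′) =
  AtMost-reflexive a (trans eq (trans (sym (++-identityʳ δ)) (sym eq′)))
Lyndon⇒Necklace {a} lyndon (γ@(_ ∷ _) , [] , eq , eq′) =
  AtMost-reflexive a (trans eq (trans (++-identityʳ γ) (sym eq′)))
Lyndon⇒Necklace {a} lyndon (γ@(_ ∷ _) , δ@(_ ∷ _) , eq , refl) = Below⇒AtMost a (lyndon γ δ eq (λ ()) (λ ()))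

power-comm : ∀ (α : List Bool) j →
  concat (replicate j α) ++ α ≡ α ++ concat (replicate j α)
power-comm α zero    = sym (++-identityʳ α)
power-comm α (suc j) = trans (++-assoc α _ α) (cong (α ++_) (power-comm α j))

power-[] : ∀ j → concat (replicate j []) ≡ [] {A = Bool}
power-[] zero    = refl
power-[] (suc j) = power-[] j

-- Rotating a proper power by its base gives the same string, against strictness. The empty string
-- is excluded because it is a power of itself.
Lyndon⇒Aperiodic : α ≢ [] → Lyndon a α → Aperiodic α
Lyndon⇒Aperiodic α≢[] _ ([] , j , _ , eq) = α≢[] (trans eq (power-[] j))
Lyndon⇒Aperiodic _ _ (_ ∷ _ , 1 , s≤s () , _)
Lyndon⇒Aperiodic {a = a} α≢[] lyndon (γ@(_ ∷ _) , suc (suc j) , _ , eq) =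
  Below-irrefl a (subst (Below a _) (trans (power-comm γ (suc j)) (sym eq)) (lyndon γ _ eq (λ ()) λ ()))

-- δ contains a, and no later than at position p.
BoundedOffset : Bool → ℕ → Pred (List Bool) _
BoundedOffset a p δ = (∀ ε → offset a (δ ++ ε) ≡ offset a δ) × offset a δ ≤ p

BoundedSuffixes : Bool → ℕ → Pred (List Bool) _
BoundedSuffixes a p y = ∀ {γ δ} → y ≡ γ ++ δ → δ ≢ [] → BoundedOffset a p δ

nonempty⇒0<length : α ≢ [] → 0 < length α
nonempty⇒0<length {[]}    α≢[] = contradiction refl α≢[]
nonempty⇒0<length {_ ∷ _} _    = s≤s z≤n

-- Rotating a suffix to the front of a necklace with offset p cannot increase the offset.
Necklace⇒BoundedSuffixes : ∀ p → Necklace a (replicate p (not a) ++ a ∷ x) → BoundedSuffixes a p x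
Necklace⇒BoundedSuffixes {a} {x} p necklace {γ} {δ} refl δ≢[] = bound (Zeros⊎offset-++ a δ)
  where
  prefix : List Bool
  prefix = replicate p (not a) ++ a ∷ γ

  split : replicate p (not a) ++ a ∷ x ≡ prefix ++ δ
  split = sym (++-assoc (replicate p (not a)) (a ∷ γ) δ)

  rotated : offset a (δ ++ prefix) ≤ p
  rotated = subst (offset a (δ ++ prefix) ≤_) (offset-source a p x)
    (AtMost⇒offset a _ (δ ++ prefix) (trans (cong length split) (length-++-comm prefix δ))
      (necklace (prefix , δ , split , refl)))

  bound : _ → BoundedOffset a p δ
  bound (inj₂ eq) = eq , subst (_≤ p) (eq prefix) rotated
  -- If `δ` had no `a`, the rotation would start with `length δ + p` letters `not a`, more than `p`.
  bound (inj₁ z)  = contradiction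
    (subst (_≤ p) (trans (offset-Zeros z prefix) (cong (_+_ _) (offset-source a p γ))) rotated)
    (<⇒≱ (m<n+m p (nonempty⇒0<length δ≢[])))

-- After a swap the whole of `y` starts with `a` and has offset 0; its proper suffixes are suffixes
-- of `x` as well.
BoundedSuffixes-Tails : ∀ {p} → Tails a x y → BoundedSuffixes a p x → BoundedSuffixes a p y
BoundedSuffixes-Tails flip bounded = bounded
BoundedSuffixes-Tails {a} (swap {x = x}) bounded {[]} refl _ =
  (λ ε → trans (offset-here a (x ++ ε)) (sym (offset-here a x))) , subst (_≤ _) (sym (offset-here a x)) z≤n
BoundedSuffixes-Tails {a} swap bounded {_ ∷ γ} refl = bounded {not a ∷ γ} refl

-- If the cut falls inside `y`, the rotation starts with a suffix of `y`, of offset at most `p` and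
-- so less than `length α`. If it falls inside `α`, the rotation starts with a shorter run of
-- `not a` followed by `y`, which contains an `a`.
BoundedSuffixes⇒Lyndon : ∀ {p} → Zeros a α → p < length α → y ≢ [] → BoundedSuffixes a p y →
                         Lyndon a (α ++ y)
BoundedSuffixes⇒Lyndon {a} {α} {y} {p} zeros p<∣α∣ y≢[] bounded γ δ eq γ≢[] δ≢[] =
  offset⇒Below a (α ++ y) (δ ++ γ)
    (trans (cong length eq) (length-++-comm γ δ))
    (subst (offset a (δ ++ γ) <_) (sym (offset-Zeros zeros y)) (bound (Levi {γ = γ} α eq)))
  where
  bound : _ → offset a (δ ++ γ) < length α + offset a y
  bound (inj₂ (ζ , _ , y≡)) with bounded y≡ δ≢[]
  ... | eq′ , ≤p = subst (_< _) (sym (eq′ γ)) (≤-<-trans ≤p (<-≤-trans p<∣α∣ (m≤m+n _ _)))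
  bound (inj₁ (ζ , α≡ , refl)) = begin-strict
    offset a ((ζ ++ y) ++ γ)  ≡⟨ cong (offset a) (++-assoc ζ y γ) ⟩
    offset a (ζ ++ y ++ γ)    ≡⟨ offset-Zeros (All.++⁻ʳ γ (subst (Zeros a) α≡ zeros)) (y ++ γ) ⟩
    length ζ + offset a (y ++ γ) ≡⟨ cong (_+_ _) (proj₁ (bounded {[]} refl y≢[]) γ) ⟩
    length ζ + offset a y     <⟨ +-monoˡ-< _ (shorter γ≢[] α≡) ⟩
    length α + offset a y     ∎
    where
    open ≤-Reasoning
    shorter : ∀ {γ} → γ ≢ [] → α ≡ γ ++ ζ → length ζ < length α
    shorter {[]}    γ≢[] _    = contradiction refl γ≢[]
    shorter {b ∷ γ} _    refl = s≤s (length-++-≤ʳ ζ {γ})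

Step-Necklace⇒Lyndon : Step a α β → Necklace a α → Lyndon a β ⊎ Zeros a β
Step-Necklace⇒Lyndon (step {x = []} p flip) _ = inj₂ (Zeros-target p [])
Step-Necklace⇒Lyndon {a} (step {x = x@(_ ∷ _)} {y} p tails) necklace =
  inj₁ (subst (Lyndon a) (++-assoc (replicate p (not a)) [ not a ] y)
    (BoundedSuffixes⇒Lyndon (Zeros-target p []) longer (nonempty tails)
      (BoundedSuffixes-Tails tails (Necklace⇒BoundedSuffixes p necklace))))
  where
  longer : p < length (replicate p (not a) ++ [ not a ])
  longer = ≤-reflexive (sym (trans (length-++ (replicate p (not a)))
             (trans (cong (_+ 1) (length-replicate p)) (+-comm p 1))))

  nonempty : ∀ {b x y} → Tails a (b ∷ x) y → y ≢ []
  nonempty flip ()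
  nonempty swap ()

Necklace-closed : ∀ a → Closed a (Necklace a)
Necklace-closed a s necklace = Sum.map₁ (λ lyndon → Lyndon⇒Necklace lyndon) (Step-Necklace⇒Lyndon s necklace)

target≢[] : Step a α β → β ≢ []
target≢[] (step zero    _) ()
target≢[] (step (suc _) _) ()

aperiodicNecklace-closed : ∀ a → Closed a (Necklace a ∩ Aperiodic)
aperiodicNecklace-closed a s (necklace , _) = Sum.map₁
  (λ lyndon → Lyndon⇒Necklace lyndon , Lyndon⇒Aperiodic (target≢[] s) lyndon)
  (Step-Necklace⇒Lyndon s necklace)

-- Prenecklaces

Step-++ : ∀ γ → Step a α β → Step a (α ++ γ) (β ++ γ)
Step-++ γ (step zero    flip) = step 0 flip
Step-++ γ (step zero    swap) = step 0 swap
Step-++ γ (step (suc p) t)    = Step-∷ (Step-++ γ (step p t))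

prefix⇒++ : IsPrefix α β → ∃[ γ ] β ≡ α ++ γ
prefix⇒++ []         = _ , refl
prefix⇒++ (refl ∷ p) with prefix⇒++ p
... | γ , refl = γ , refl

prefix-++ : ∀ α → IsPrefix α (α ++ β)
prefix-++ []      = []
prefix-++ (b ∷ α) = refl ∷ prefix-++ α

-- The same step applies to the completed word, with the completion `γ` unchanged; if the result
-- consists of `not a` only, so does its prefix.
PrefixOf-closed : {P : Pred (List Bool) ℓ} → Closed a P → Closed a (PrefixOf P)
PrefixOf-closed closed s (_ , Pαγ , pre) with prefix⇒++ pre
... | γ , refl = Sum.map (λ Pβγ → _ , Pβγ , prefix-++ _) (All.++⁻ˡ _) (closed (Step-++ γ s) Pαγ)

-- Counting

count-same : ∀ b α → count b (b ∷ α) ≡ suc (count b α)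
count-same 𝟘 α = refl
count-same 𝟙 α = refl

count-other : ∀ b α → count b (not b ∷ α) ≡ count b α
count-other 𝟘 α = refl
count-other 𝟙 α = refl

count-other′ : ∀ b α → count (not b) (b ∷ α) ≡ count (not b) α
count-other′ 𝟘 α = refl
count-other′ 𝟙 α = refl

count-mono-∷ : ∀ b c → count b α ≤ count b β → count b (c ∷ α) ≤ count b (c ∷ β)
count-mono-∷ b c le with b ≟ c
... | yes _ = s≤s le
... | no  _ = le

count-++ : ∀ b α β → count b (α ++ β) ≡ count b α + count b β
count-++ b α β = trans (cong length (filter-++ (b ≟_) α β)) (length-++ (filter (b ≟_) α))

count-replicate-same : ∀ b n → count b (replicate n b) ≡ n
count-replicate-same b zero    = refl
count-replicate-same b (suc n) = trans (count-same b _) (cong suc (count-replicate-same b n))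

count-replicate-other : ∀ b n → count b (replicate n (not b)) ≡ 0
count-replicate-other b zero    = refl
count-replicate-other b (suc n) = trans (count-other b _) (count-replicate-other b n)

count-take-≤ : ∀ b m α → count b (take m α) ≤ m
count-take-≤ b m α = ≤-trans (length-filter (b ≟_) (take m α))
  (subst (_≤ m) (sym (length-take m α)) (m⊓n≤m m _))

count-take-mono : ∀ b {m n} α → m ≤ n → count b (take m α) ≤ count b (take n α)
count-take-mono b {m} []  m≤n       = subst (λ γ → count b γ ≤ _) (sym (take-[] m)) z≤n
count-take-mono b (c ∷ α) z≤n       = z≤n
count-take-mono b (c ∷ α) (s≤s m≤n) = count-mono-∷ b c (count-take-mono b α m≤n)

-- A flip adds one `not a`, and a swap moves one a place to the left; neither can lower the count in
-- a prefix.
Step⇒count-not-≤ : Step a α β → ∀ m → count (not a) (take m α) ≤ count (not a) (take m β)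
Step⇒count-not-≤ _ zero = z≤n
Step⇒count-not-≤ {a} (step {x} {y} zero t) (suc m)
  rewrite count-other′ a (take m x) | count-same (not a) (take m y) = tails t m
  where
  tails : ∀ {x y} → Tails a x y → ∀ m → count (not a) (take m x) ≤ suc (count (not a) (take m y))
  tails flip             m       = n≤1+n _
  tails swap             zero    = z≤n
  tails (swap {x = x})   (suc m)
    rewrite count-same (not a) (take m x) | count-other′ a (take m x) = ≤-refl
Step⇒count-not-≤ {a} (step (suc p) t) (suc m) = count-mono-∷ (not a) (not a) (Step⇒count-not-≤ (step p t) m)

Step⇒count-≥ : Step a α β → ∀ m → count a (take m β) ≤ count a (take m α)
Step⇒count-≥ _ zero = z≤n
Step⇒count-≥ {a} (step {x} {y} zero t) (suc m)
  rewrite count-same a (take m x) | count-other a (take m y) = tails t m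
  where
  tails : ∀ {x y} → Tails a x y → ∀ m → count a (take m y) ≤ suc (count a (take m x))
  tails flip           m       = n≤1+n _
  tails swap           zero    = z≤n
  tails (swap {x = x}) (suc m)
    rewrite count-same a (take m x) | count-other a (take m x) = ≤-refl
Step⇒count-≥ {a} (step (suc p) t) (suc m) = count-mono-∷ a (not a) (Step⇒count-≥ (step p t) m)

take-length : ∀ {m} (α : List Bool) → length α ≡ m → take m α ≡ α
take-length α refl = take-all (length α) α ≤-refl

Step⇒count-not-total : Step a α β → count (not a) α ≤ count (not a) β
Step⇒count-not-total {a} {α} {β} s =
  subst₂ (λ μ ν → count (not a) μ ≤ count (not a) ν)
    (take-length α refl) (take-length β (sym (length-Step s))) (Step⇒count-not-≤ s (length α))

Step⇒count-total : Step a α β → count a β ≤ count a α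
Step⇒count-total {a} {α} {β} s =
  subst₂ (λ μ ν → count a μ ≤ count a ν)
    (take-length β (sym (length-Step s))) (take-length α refl) (Step⇒count-≥ s (length α))

weight-≤-closed : ∀ a k → Closed a (λ α → + count a α ℤ.≤ k)
weight-≤-closed a k s le = inj₁ (ℤ.≤-trans (ℤ.+≤+ (Step⇒count-total s)) le)

weight-≥-closed : ∀ a k → Closed a (λ α → k ℤ.≤ + count (not a) α)
weight-≥-closed a k s le = inj₁ (ℤ.≤-trans le (ℤ.+≤+ (Step⇒count-not-total s)))

-- Prefix normal words

Subadditive : Bool → Pred (List Bool) _
Subadditive b α = ∀ i j → count b (take (i + j) α) ≤ count b (take i α) + count b (take j α)

count-take-+ : ∀ b i j α → count b (take (i + j) α) ≡ count b (take i α) + count b (take j (drop i α))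
count-take-+ b i j α = trans (cong (count b) (take-+ i j α)) (count-++ b (take i α) _)
  where
  take-+ : ∀ i j (α : List Bool) → take (i + j) α ≡ take i α ++ take j (drop i α)
  take-+ zero    j α       = refl
  take-+ (suc i) j []      = sym (take-[] j)
  take-+ (suc i) j (c ∷ α) = cong (c ∷_) (take-+ i j α)

substring-take-drop : ∀ i j α → IsSubstring (take j (drop i α)) α
substring-take-drop zero    j α       = here (subst (IsPrefix (take j α)) (take++drop≡id j α) (prefix-++ (take j α)))
substring-take-drop (suc i) j []      = subst (λ γ → IsSubstring γ []) (sym (take-[] j)) (here [])
substring-take-drop (suc i) j (c ∷ α) = there (substring-take-drop i j α)

substring⇒take-drop : IsSubstring β α → ∃[ i ] β ≡ take (length β) (drop i α)
substring⇒take-drop (here p)  = 0 , prefix⇒take p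
  where
  prefix⇒take : ∀ {α β} → IsPrefix β α → β ≡ take (length β) α
  prefix⇒take []         = refl
  prefix⇒take (refl ∷ p) = cong (_ ∷_) (prefix⇒take p)
substring⇒take-drop (there s) with substring⇒take-drop s
... | i , eq = suc i , eq

PrefixNormal⇒Subadditive : PrefixNormal b α → Subadditive b α
PrefixNormal⇒Subadditive {b} {α} normal i j rewrite count-take-+ b i j α =
  +-monoʳ-≤ (count b (take i α))
    -- The substring can be shorter than `j` if `i + j` runs past the end of `α`; monotonicity of
    -- the prefix counts absorbs this.
    (≤-trans (normal (substring-take-drop i j α)) (count-take-mono b α length≤))
  where
  length≤ : length (take j (drop i α)) ≤ j
  length≤ = subst (_≤ j) (sym (length-take j (drop i α))) (m⊓n≤m j _)

Subadditive⇒PrefixNormal : Subadditive b α → PrefixNormal b α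
Subadditive⇒PrefixNormal {b} {α} sub {β} s with substring⇒take-drop s
... | i , eq = +-cancelˡ-≤ (count b (take i α)) _ _ (begin
  count b (take i α) + count b β ≡⟨ cong (λ γ → _ + count b γ) eq ⟩
  count b (take i α) + count b (take (length β) (drop i α)) ≡⟨ count-take-+ b i (length β) α ⟨
  count b (take (i + length β) α) ≤⟨ sub i (length β) ⟩
  count b (take i α) + count b (take (length β) α) ∎)
  where open ≤-Reasoning

count-take-target-≤ : ∀ a p y {m} → m ≤ suc p →
  count (not a) (take m (replicate p (not a) ++ not a ∷ y)) ≡ m
count-take-target-≤ a p       y {zero}  _       = refl
count-take-target-≤ a zero    y {suc .0} (s≤s z≤n) = count-same (not a) []
count-take-target-≤ a (suc p) y {suc m} (s≤s m≤) =
  trans (count-same (not a) _) (cong suc (count-take-target-≤ a p y m≤))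

gain : Tails a x y → ℕ
gain flip = 1
gain swap = 0

-- For a swap the prefix counts of source and target differ only at length `p + 1`, which the strict
-- bound excludes; from `p + 2` on both swapped letters are counted.
count-take-target-> : ∀ p (t : Tails a x y) {m} → suc p < m →
  count (not a) (take m (replicate p (not a) ++ not a ∷ y))
    ≡ gain t + count (not a) (take m (replicate p (not a) ++ a ∷ x))
count-take-target-> zero _ {suc zero} (s≤s ())
count-take-target-> {a} zero (flip {x = x}) {suc (suc m)} _
  rewrite count-same (not a) (take (suc m) x) | count-other′ a (take (suc m) x) = refl
count-take-target-> {a} zero (swap {x = x}) {suc (suc m)} _
  rewrite count-same (not a) (a ∷ take m x) | count-other′ a (take m x)
        | count-other′ a (not a ∷ take m x) | count-same (not a) (take m x) = refl
count-take-target-> {a} (suc p) t {suc m} (s≤s lt) =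
  trans (count-same (not a) _)
    (trans (cong suc (count-take-target-> p t lt))
      (trans (sym (+-suc (gain t) _)) (cong (_+_ (gain t)) (sym (count-same (not a) _)))))

-- Within its first p + 1 letters the target of a step is constant, and beyond them its prefix
-- counts exceed those of the source by a constant.
Subadditive-Step : Step a α β → Subadditive (not a) α → Subadditive (not a) β
Subadditive-Step {a} {α} {β} s@(step {x} {y} p t) sub = split
  where
  open ≤-Reasoning

  #α #β : ℕ → ℕ
  #α m = count (not a) (take m α)
  #β m = count (not a) (take m β)

  beyond : ∀ i j → suc p < i → #β (i + j) ≤ #β i + #β j
  beyond i j p<i = begin
    #β (i + j)             ≡⟨ count-take-target-> p t (<-≤-trans p<i (m≤m+n i j)) ⟩
    gain t + #α (i + j)    ≤⟨ +-monoʳ-≤ (gain t) (sub i j) ⟩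
    gain t + (#α i + #α j) ≡⟨ +-assoc (gain t) (#α i) (#α j) ⟨
    gain t + #α i + #α j   ≡⟨ cong (_+ #α j) (count-take-target-> p t p<i) ⟨
    #β i + #α j            ≤⟨ +-monoʳ-≤ (#β i) (Step⇒count-not-≤ s j) ⟩
    #β i + #β j            ∎

  split : Subadditive (not a) β
  split i j with i ≤? suc p | j ≤? suc p
  ... | no i≰  | _      = beyond i j (≰⇒> i≰)
  ... | yes _  | no j≰  = subst₂ _≤_ (cong #β (+-comm j i)) (+-comm (#β j) (#β i)) (beyond j i (≰⇒> j≰))
  ... | yes i≤ | yes j≤ = begin
    #β (i + j)  ≤⟨ count-take-≤ (not a) (i + j) β ⟩
    i + j       ≡⟨ cong₂ _+_ (count-take-target-≤ a p y i≤) (count-take-target-≤ a p y j≤) ⟨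
    #β i + #β j ∎

prefixNormal-closed : ∀ a → Closed a (PrefixNormal (not a))
prefixNormal-closed a s normal =
  inj₁ (Subadditive⇒PrefixNormal (Subadditive-Step s (PrefixNormal⇒Subadditive normal)))

≡⊎≡not : ∀ a b → b ≡ a ⊎ b ≡ not a
≡⊎≡not a b with b ≟ a
... | yes b≡a = inj₁ b≡a
... | no  b≢a = inj₂ (¬-not b≢a)

-- Inversions and transpositions

length-filter-++ : ∀ {A : Set} {P : Pred A 0ℓ} (P? : Decidable P) xs ys →
  length (filter P? (xs ++ ys)) ≡ length (filter P? xs) + length (filter P? ys)
length-filter-++ P? xs ys = trans (cong length (filter-++ P? xs ys)) (length-++ (filter P? xs))

-- The index pairs are split by first component: row `zero` counts the letters `not a` of `α` when
-- `b` is `a`, and the remaining rows reproduce the pairs of `α`.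
inversions-∷ : ∀ a b α →
  inversions a (b ∷ α) ≡ (if does (b ≟ a) then count (not a) α else 0) + inversions a α
inversions-∷ a b α = begin
  #′ (cartesianProduct (zero ∷ tabulate suc) (zero ∷ tabulate suc))
    ≡⟨ cong (λ is → #′ (cartesianProduct (zero ∷ is) (zero ∷ is))) (map-tabulate id suc) ⟨
  #′ (map (zero ,_) (map suc js) ++ cartesianProduct (map suc js) (zero ∷ map suc js))
    ≡⟨ length-filter-++ (inversion? a (b ∷ α)) (map (zero ,_) (map suc js)) _ ⟩
  #′ (map (zero ,_) (map suc js)) + #′ (cartesianProduct (map suc js) (zero ∷ map suc js))
    ≡⟨ cong₂ _+_ (trans (first-row js) (cong (λ γ → if does (b ≟ a) then count (not a) γ else 0) lookups))
                 (later-rows js js) ⟩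
  (if does (b ≟ a) then count (not a) α else 0) + inversions a α ∎
  where
  open ≡-Reasoning

  js : List (Fin (length α))
  js = allFin (length α)

  # : List (Fin (length α) × Fin (length α)) → ℕ
  # ps = length (filter (inversion? a α) ps)

  #′ : List (Fin (suc (length α)) × Fin (suc (length α))) → ℕ
  #′ ps = length (filter (inversion? a (b ∷ α)) ps)

  lookups : map (lookup α) js ≡ α
  lookups = trans (map-tabulate id (lookup α)) (tabulate-lookup α)

  -- `count` compares the fixed letter with the entry, `inversion?` the entry with the fixed letter.
  ≟-comm : ∀ c d → does (c ≟ d) ≡ does (d ≟ c)
  ≟-comm 𝟘 𝟘 = refl
  ≟-comm 𝟘 𝟙 = refl
  ≟-comm 𝟙 𝟘 = refl
  ≟-comm 𝟙 𝟙 = refl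

  first-row : ∀ js → #′ (map (zero ,_) (map suc js))
                   ≡ (if does (b ≟ a) then count (not a) (map (lookup α) js) else 0)
  first-row [] with does (b ≟ a)
  ... | 𝟙 = refl
  ... | 𝟘 = refl
  first-row (j ∷ js) with ih ← first-row js with does (b ≟ a)
  ... | 𝟘 = ih
  ... | 𝟙 rewrite ≟-comm (not a) (lookup α j) with does (lookup α j ≟ not a)
  ...   | 𝟙 = cong suc ih
  ...   | 𝟘 = ih

  later-row : ∀ i js → #′ (map (suc i ,_) (map suc js)) ≡ # (map (i ,_) js)
  later-row i []       = refl
  later-row i (j ∷ js) with does (inversion? a α (i , j))
  ... | 𝟙 = cong suc (later-row i js)
  ... | 𝟘 = later-row i js

  later-rows : ∀ is js → #′ (cartesianProduct (map suc is) (zero ∷ map suc js)) ≡ # (cartesianProduct is js)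
  later-rows []       js = refl
  later-rows (i ∷ is) js = begin
    -- The pair `(suc i , zero)` is not increasing, so `filter` has already dropped it by
    -- computation.
    #′ (map (suc i ,_) (map suc js) ++ cartesianProduct (map suc is) (zero ∷ map suc js))
      ≡⟨ length-filter-++ (inversion? a (b ∷ α)) (map (suc i ,_) (map suc js)) _ ⟩
    #′ (map (suc i ,_) (map suc js)) + #′ (cartesianProduct (map suc is) (zero ∷ map suc js))
      ≡⟨ cong₂ _+_ (later-row i js) (later-rows is js) ⟩
    # (map (i ,_) js) + # (cartesianProduct is js)
      ≡⟨ length-filter-++ (inversion? a α) (map (i ,_) js) _ ⟨
    # (map (i ,_) js ++ cartesianProduct is js) ∎

inversions-here : ∀ a α → inversions a (a ∷ α) ≡ count (not a) α + inversions a α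
inversions-here a α with a ≟ a | inversions-∷ a a α
... | yes _  | eq = eq
... | no a≢a | _  = contradiction refl a≢a

inversions-there : ∀ a α → inversions a (not a ∷ α) ≡ inversions a α
inversions-there a α with not a ≟ a | inversions-∷ a (not a) α
... | no _   | eq = eq
... | yes eq | _  = contradiction (sym eq) (not-¬ refl)

inversions-transpose : ∀ a α → inversions a (a ∷ not a ∷ α) ≡ suc (inversions a (not a ∷ a ∷ α))
inversions-transpose a α
  rewrite inversions-here a (not a ∷ α) | inversions-there a α | count-same (not a) α
        | inversions-there a (a ∷ α) | inversions-here a α = refl

-- All letters before the changed place are `not a`, so the new `not a` there closes no inversion. A
-- flip only loses inversions, and a swap removes exactly one.
Step⇒inversions : Step a α β → inversions a β ≤ inversions a α
Step⇒inversions {a} (step zero (flip {x = x}))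
  rewrite inversions-here a x | inversions-there a x = m≤n+m _ _
Step⇒inversions {a} (step zero (swap {x = x})) rewrite inversions-transpose a x = n≤1+n _
Step⇒inversions {a} (step {x} {y} (suc p) t)
  = subst₂ _≤_ (sym (inversions-there a (replicate p (not a) ++ not a ∷ y)))
               (sym (inversions-there a (replicate p (not a) ++ a ∷ x)))
               (Step⇒inversions (step p t))

inversions-closed : ∀ a k → Closed a (λ α → + inversions a α ℤ.≤ k)
inversions-closed a k s le = inj₁ (ℤ.≤-trans (ℤ.+≤+ (Step⇒inversions s)) le)

transposition⇒↭ : AdjacentTransposition α β → α ↭ β
transposition⇒↭ here      = swap _ _ ↭-refl
transposition⇒↭ (there s) = prep _ (transposition⇒↭ s)

Transforms⇒↭ : ∀ {m} → Transforms m α β → α ↭ β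
Transforms⇒↭ done        = ↭-refl
Transforms⇒↭ (step τ τs) = ↭-trans (transposition⇒↭ τ) (Transforms⇒↭ τs)

count-↭ : ∀ b → α ↭ β → count b α ≡ count b β
count-↭ b α↭β = ↭-length (filter-↭ (b ≟_) α↭β)

-- Only the transposed pair changes its status. Under a common first letter the count of `not a`
-- behind it is the same, as a transposition permutes the letters.
transposition-inversions : ∀ a → AdjacentTransposition α β → inversions a α ≤ suc (inversions a β)
transposition-inversions a (here {b} {c} {α}) with ≡⊎≡not a b | ≡⊎≡not a c
... | inj₁ refl | inj₁ refl = n≤1+n _
... | inj₁ refl | inj₂ refl = ≤-reflexive (inversions-transpose a α)
... | inj₂ refl | inj₁ refl = m≤n⇒m≤1+n (≤-trans (n≤1+n _) (≤-reflexive (sym (inversions-transpose a α))))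
... | inj₂ refl | inj₂ refl = n≤1+n _
transposition-inversions a (there {α} {β} {b} s) with ≡⊎≡not a b
... | inj₁ refl = begin
  inversions a (a ∷ α)                     ≡⟨ inversions-here a α ⟩
  count (not a) α + inversions a α         ≤⟨ +-monoʳ-≤ (count (not a) α) (transposition-inversions a s) ⟩
  count (not a) α + suc (inversions a β)   ≡⟨ +-suc _ _ ⟩
  suc (count (not a) α + inversions a β)
    ≡⟨ cong (λ m → suc (m + inversions a β)) (count-↭ (not a) (transposition⇒↭ s)) ⟩
  suc (count (not a) β + inversions a β)   ≡⟨ cong suc (inversions-here a β) ⟨
  suc (inversions a (a ∷ β))               ∎
  where open ≤-Reasoning
... | inj₂ refl = subst₂ (λ m n → m ≤ suc n)
  (sym (inversions-there a α)) (sym (inversions-there a β)) (transposition-inversions a s)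

Transforms-inversions : ∀ a {m} → Transforms m α β → inversions a α ≤ m + inversions a β
Transforms-inversions a done         = ≤-refl
Transforms-inversions a (step τ τs) =
  ≤-trans (transposition-inversions a τ) (s≤s (Transforms-inversions a τs))

Transforms-∷ : ∀ b {m} → Transforms m α β → Transforms m (b ∷ α) (b ∷ β)
Transforms-∷ b done        = done
Transforms-∷ b (step τ τs) = step (there τ) (Transforms-∷ b τs)

Transforms-trans : ∀ {m k} → Transforms m α β → Transforms k β γ → Transforms (m + k) α γ
Transforms-trans done        σs = σs
Transforms-trans (step τ τs) σs = step τ (Transforms-trans τs σs)

inversions-runs : ∀ a s t → inversions a (runs a (s , t)) ≡ 0
inversions-runs a zero    zero    = refl
inversions-runs a zero    (suc t) = trans (inversions-here a (replicate t a))
  (cong₂ _+_ (count-a t) (inversions-runs a zero t))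
  where
  count-a : ∀ t → count (not a) (replicate t a) ≡ 0
  count-a zero    = refl
  count-a (suc t) = trans (count-other′ a _) (count-a t)
inversions-runs a (suc s) t       = trans (inversions-there a (runs a (s , t))) (inversions-runs a s t)

insert : ∀ a s t → Transforms s (a ∷ runs a (s , t)) (runs a (s , suc t))
insert a zero    t = done
insert a (suc s) t = step here (Transforms-∷ (not a) (insert a s t))

count-runs : ∀ a s t → count (not a) (runs a (s , t)) ≡ s
count-runs a zero    zero    = refl
count-runs a zero    (suc t) = trans (count-other′ a _) (count-runs a zero t)
count-runs a (suc s) t       = trans (count-same (not a) _) (cong suc (count-runs a s t))

-- Insertion sort: a leading `a` crosses every `not a` of the sorted tail, and there are as many of
-- these as in `α`, which is exactly the number of inversions it starts.
sort : ∀ a α → ∃₂ λ s t → Transforms (inversions a α) α (runs a (s , t))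
sort a [] = 0 , 0 , done
sort a (b ∷ α) with sort a α | ≡⊎≡not a b
... | s , t , τs | inj₂ refl = suc s , t ,
  subst (λ m → Transforms m (not a ∷ α) (runs a (suc s , t)))
    (sym (inversions-there a α)) (Transforms-∷ (not a) τs)
... | s , t , τs | inj₁ refl = s , suc t ,
  subst (λ m → Transforms m (a ∷ α) (runs a (s , suc t)))
    steps (Transforms-trans (Transforms-∷ a τs) (insert a s t))
  where
  open ≡-Reasoning
  steps : inversions a α + s ≡ inversions a (a ∷ α)
  steps = begin
    inversions a α + s                                 ≡⟨ +-comm _ s ⟩
    s + inversions a α                                 ≡⟨ cong (_+ _) (count-runs a s t) ⟨
    count (not a) (runs a (s , t)) + inversions a α    ≡⟨ cong (_+ _) (count-↭ (not a) (Transforms⇒↭ τs)) ⟨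
    count (not a) α + inversions a α                   ≡⟨ inversions-here a α ⟨
    inversions a (a ∷ α)                               ∎

-- Each transposition removes at most one inversion, and a sorted string has none.
sorted-inversions : ∀ a {m} → SortedForm a β → Transforms m α β → inversions a α ≤ m
sorted-inversions a {m} ((s , t) , refl) τs =
  subst (_ ≤_) (trans (cong (_+_ m) (inversions-runs a s t)) (+-identityʳ m)) (Transforms-inversions a τs)

inversions-isTranspositionNumber : ∀ a α → IsTranspositionNumber (SortedForm a) α (inversions a α)
inversions-isTranspositionNumber a α with sort a α
... | s , t , τs = (_ , ((s , t) , refl) , τs) , sorted-inversions a

transpositions-closed : ∀ a k → Closed a (TranspositionsAtMost k a)
transpositions-closed a k {β = β} s (m , ((_ , sorted , τs) , _) , m≤k) = inj₁
  (inversions a β , inversions-isTranspositionNumber a β ,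
   ℤ.≤-trans (ℤ.+≤+ (≤-trans (Step⇒inversions s) (sorted-inversions a sorted τs))) m≤k)

-- Left factors of Dyck words

-- Here `k` is one less than the arity: `Ballot b k` goes with `DyckWord b (suc k)`.
Ballot : Bool → ℕ → Pred (List Bool) _
Ballot b k α = ∀ m → count (not b) (take m α) ≤ k * count b (take m α)

leftFactor⇒Ballot : ∀ {k} → PrefixOf (DyckWord b (suc k)) α → Ballot b k α
leftFactor⇒Ballot {α = α} (_ , dyck , pre) m with prefix⇒++ pre
... | γ , refl = DyckWord.prefixes dyck (take-prefix m α)
  where
  take-prefix : ∀ m α → IsPrefix (take m α) (α ++ γ)
  take-prefix zero    α       = []
  take-prefix (suc m) []      = []
  take-prefix (suc m) (c ∷ α) = refl ∷ take-prefix m α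

count+count-not : ∀ b α → count b α + count (not b) α ≡ length α
count+count-not b [] = refl
count+count-not b (c ∷ α) with b ≟ c
... | yes refl rewrite count-other′ b α = cong suc (count+count-not b α)
... | no b≢c rewrite ¬-not (b≢c ∘ sym) | count-same (not b) α =
  trans (+-suc _ _) (cong suc (count+count-not b α))

count-++-≤ : ∀ b α γ → count b α ≤ count b (α ++ γ)
count-++-≤ b α γ = subst (count b α ≤_) (sym (count-++ b α γ)) (m≤m+n _ _)

-- Pad with as many letters not b as the ballot condition for α itself leaves room for.
Ballot⇒leftFactor : ∀ k → Ballot b k α → PrefixOf (DyckWord b (suc k)) α
Ballot⇒leftFactor {b} {α} k ballot = word , dyck , prefix-++ α
  where
  open ≤-Reasoning
  enough : count (not b) α ≤ k * count b α
  enough = subst (λ γ → count (not b) γ ≤ k * count b γ) (take-length α refl) (ballot (length α))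

  room : ℕ
  room = k * count b α ∸ count (not b) α

  padding word : List Bool
  padding = replicate room (not b)
  word    = α ++ padding

  count-word : count b word ≡ count b α
  count-word = trans (count-++ b α padding)
    (trans (cong (_+_ (count b α)) (count-replicate-other b room)) (+-identityʳ _))

  count-not-word : count (not b) word ≡ k * count b α
  count-not-word = trans (count-++ (not b) α padding)
    (trans (cong (_+_ (count (not b) α)) (count-replicate-same (not b) room)) (m+[n∸m]≡n enough))

  take-length-++ : ∀ γ {ζ} → take (length γ) (γ ++ ζ) ≡ γ
  take-length-++ []      = refl
  take-length-++ (c ∷ γ) = cong (c ∷_) (take-length-++ γ)

  prefixes : IsPrefix γ word → count (not b) γ ≤ k * count b γ
  prefixes {γ} pre with prefix⇒++ pre
  ... | δ , eq with Levi {γ = γ} α eq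
  ...   | inj₁ (ζ , refl , _) = subst (λ γ → count (not b) γ ≤ k * count b γ)
    (take-length-++ γ) (ballot (length γ))
  -- A prefix reaching into the padding already has every `b` of the word, and at most as many
  -- `not b` as the whole word, where the bound is attained.
  ...   | inj₂ (ζ , refl , _) = begin
    count (not b) γ    ≤⟨ count-++-≤ (not b) γ δ ⟩
    count (not b) (γ ++ δ) ≡⟨ cong (count (not b)) eq ⟨
    count (not b) word ≡⟨ count-not-word ⟩
    k * count b α      ≤⟨ *-monoʳ-≤ k (count-++-≤ b α ζ) ⟩
    k * count b γ      ∎

  dyck : DyckWord b (suc k) word
  dyck = record
    { t         = count b α
    ; length≡   = trans (sym (count+count-not b word))
        (trans (cong₂ _+_ count-word (trans count-not-word (*-comm k (count b α)))) (sym (*-suc (count b α) k)))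
    ; count≡    = count-word
    ; countNot≡ = trans count-not-word (*-comm k (count b α))
    ; prefixes  = prefixes
    }

-- For arity 0 the length `t * 0` leaves only the empty word, from which no step starts.
leftFactor-zero : PrefixOf (DyckWord b 0) α → α ≡ []
leftFactor-zero ([]    , _    , []) = refl
leftFactor-zero (_ ∷ _ , dyck , _)
  with () ← trans (DyckWord.length≡ dyck) (*-zeroʳ (DyckWord.t dyck))

-- In every prefix a step can only lower the count of `a` and raise that of `not a`; both changes
-- favour the ballot condition in which `not a` is the dominant letter.
leftFactor-closed : ∀ a k → Closed a (PrefixOf (DyckWord (not a) k))
leftFactor-closed a zero s factor =
  contradiction s (Zeros⇒¬Step (subst (Zeros a) (sym (leftFactor-zero factor)) []))
leftFactor-closed a (suc k) {α} {β} s factor = inj₁ (Ballot⇒leftFactor k ballot)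
  where
  open ≤-Reasoning
  ballot : Ballot (not a) k β
  ballot m = begin
    count (not (not a)) (take m β) ≡⟨ cong (λ c → count c (take m β)) (not-involutive a) ⟩
    count a (take m β)             ≤⟨ Step⇒count-≥ s m ⟩
    count a (take m α)             ≡⟨ cong (λ c → count c (take m α)) (not-involutive a) ⟨
    count (not (not a)) (take m α) ≤⟨ leftFactor⇒Ballot factor m ⟩
    k * count (not a) (take m α)   ≤⟨ *-monoʳ-≤ k (Step⇒count-not-≤ s m) ⟩
    k * count (not a) (take m β)   ∎

-- Pseudo-necklaces

first-run : ∀ p s t → replicate p (not a) ++ a ∷ x ≡ runs a (s , suc t) ++ γ →
            p ≡ s × x ≡ replicate t a ++ γ
first-run zero    zero    t eq = refl , ∷-injectiveʳ eq
first-run zero    (suc s) t eq = contradiction (∷-injectiveˡ eq) (not-¬ refl)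
first-run (suc p) zero    t eq = contradiction (sym (∷-injectiveˡ eq)) (not-¬ refl)
first-run (suc p) (suc s) t eq with first-run p s t (∷-injectiveʳ eq)
... | refl , x≡ = refl , x≡

runs-prepend : ∀ p {s t} → replicate p (not a) ++ not a ∷ runs a (s , t) ++ γ
                         ≡ runs a (suc p + s , t) ++ γ
runs-prepend zero    = refl
runs-prepend (suc p) = cong (_ ∷_) (runs-prepend p)

≤ᴮ⇒≥ : ∀ {s t B} → (s , t) ≤ᴮ B → proj₁ B ≤ s
≤ᴮ⇒≥ (inj₁ (inj₁ s′<s))       = <⇒≤ s′<s
≤ᴮ⇒≥ (inj₁ (inj₂ (refl , _))) = ≤-refl
≤ᴮ⇒≥ (inj₂ refl)              = ≤-refl

-- A first block `(p , t)` that is least bounds every other run of `not a` by `p`. A run of at least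
-- `p + 1` thus makes the new first block strictly smaller, whatever its number of `a`.
longer-first : ∀ {p t k t′ Bs} → All ((p , t) ≤ᴮ_) Bs → All ((suc p + k , t′) ≤ᴮ_) Bs
longer-first = All.map λ B≤ → inj₁ (inj₁ (s≤s (≤-trans (≤ᴮ⇒≥ B≤) (m≤m+n _ _))))

relink : ∀ {s t s′ t′ Bs} → (0 < t → 0 < t′) →
         Linked MaximalAt ((s , t) ∷ Bs) → Linked MaximalAt ((s′ , t′) ∷ Bs)
relink f [-]              = [-]
relink f ((t>0 , s>0) ∷ l) = (f t>0 , s>0) ∷ l

-- The step lengthens the leading run of `not a` in the first block and changes at most the next
-- block; what remains is to recompute the block decomposition.
pseudoNecklace-closed : ∀ a → Closed a (PseudoNecklace a)
pseudoNecklace-closed a s (B@(s₁ , zero) , [] , dec , _) =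
  contradiction (subst (λ α → Step a α _) (IsBlockDecomposition.concatenates dec) s)
    (Zeros⇒¬Step (All.++⁺ (All.++⁺ (All.replicate⁺ s₁ refl) []) []))
pseudoNecklace-closed a s ((_ , zero) , _ ∷ _ , dec , _)
  with (() , _) ∷ _ ← IsBlockDecomposition.maximal dec
pseudoNecklace-closed a (step p tails) ((s , suc t) , Bs , dec , least)
  with refl , x≡ ← first-run p s t (IsBlockDecomposition.concatenates dec)
  = go tails t Bs x≡ (IsBlockDecomposition.nonEmpty dec) (IsBlockDecomposition.maximal dec) least
  where
  assemble : ∀ {y} k t Bs → y ≡ concatMap (runs a) ((k , t) ∷ Bs) →
    All NonEmpty Bs → Linked MaximalAt ((suc p + k , t) ∷ Bs) → All ((suc p + k , t) ≤ᴮ_) Bs →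
    PseudoNecklace a (replicate p (not a) ++ not a ∷ y)
  assemble k t Bs refl ne linked least =
    _ , Bs , record { concatenates = runs-prepend p ; nonEmpty = s≤s z≤n ∷ ne ; maximal = linked } , least

  go : ∀ {x y} → Tails a x y → ∀ t Bs → x ≡ replicate t a ++ concatMap (runs a) Bs →
    All NonEmpty ((p , suc t) ∷ Bs) → Linked MaximalAt ((p , suc t) ∷ Bs) → All ((p , suc t) ≤ᴮ_) Bs →
    PseudoNecklace a (replicate p (not a) ++ not a ∷ y) ⊎ Zeros a (replicate p (not a) ++ not a ∷ y)
  go flip zero    []               refl _            _            _           = inj₂ (Zeros-target p [])
  -- Flipping the only `a` of the first block merges it with the second.
  go flip zero    ((s , t) ∷ Bs)   refl (_ ∷ _ ∷ ne) (_ ∷ linked) (_ ∷ least) =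
    inj₁ (assemble s t Bs refl ne (relink id linked) (longer-first least))
  go flip (suc t) Bs               refl (_ ∷ ne)     linked       least       =
    inj₁ (assemble 0 (suc t) Bs refl ne (relink (λ _ → s≤s z≤n) linked) (longer-first least))
  go swap (suc t) Bs               eq   _            _            _           =
    contradiction (sym (∷-injectiveˡ eq)) (not-¬ refl)
  go swap zero    ((zero , t) ∷ Bs) _   _            ((_ , ()) ∷ _) _
  -- The swap uses up the single `not a` of the second block, whose letters `a` join the first.
  go swap zero    ((suc zero , t) ∷ Bs) refl (_ ∷ _ ∷ ne) (_ ∷ linked) (_ ∷ least) =
    inj₁ (assemble 0 (suc t) Bs refl ne (relink (λ _ → s≤s z≤n) linked) (longer-first least))
  -- Both blocks survive: the first gains a `not a` and the second loses one, so its run still has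
  -- length at most `p`.
  go swap zero    ((suc (suc s) , t) ∷ Bs) refl (_ ∷ _ ∷ ne) (_ ∷ linked) (B≤ ∷ least) =
    inj₁ (assemble 0 1 ((suc s , t) ∷ Bs) refl (s≤s z≤n ∷ ne)
      ((s≤s z≤n , s≤s z≤n) ∷ relink id linked)
      (inj₁ (inj₁ (≤-trans (≤ᴮ⇒≥ B≤) (≤-trans (n≤1+n p) (m≤m+n (suc p) 0)))) ∷ longer-first least))

-- Knapsack

module _ {c ℓ₁ ℓ₂} (M : CommutativePomonoid c ℓ₁ ℓ₂) where
  open CommutativePomonoid M
    using (Carrier; ε; _≼_; isPartialOrder; ∙-mono; identityˡ; rawMonoid)
    renaming (sym to ≈-sym)
  open IsPartialOrder isPartialOrder using ()
    renaming (refl to ≼-refl; reflexive to ≼-reflexive; trans to ≼-trans)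
  open RawMonoidDefs rawMonoid using (sum)

  load : Vector Carrier n → Vec Bool n → Carrier
  load w α = sum (λ i → if Vec.lookup α i then w i else ε)

  flip-load : ∀ {w : Vector Carrier n} {u v} → (∀ i → ε ≼ w i) → FlipFirst 𝟙 u v → load w v ≼ load w u
  flip-load nonNeg here        = ∙-mono (nonNeg zero) ≼-refl
  flip-load nonNeg (there _ f) = ∙-mono ≼-refl (flip-load (nonNeg ∘ suc) f)

  -- A swap replaces a chosen item by the next one, which is no heavier, or exchanges two chosen
  -- items and changes nothing.
  swap-load : ∀ {w : Vector Carrier n} {u v} → (∀ {i j} → toℕ j ≡ suc (toℕ i) → w j ≼ w i) →
              SwapFirst 𝟙 u v → load w v ≼ load w u
  swap-load dec (here {b = 𝟙}) = ≼-refl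
  swap-load dec (here {b = 𝟘}) = ≼-trans (≼-reflexive (identityˡ _))
    (∙-mono (dec {zero} {suc zero} refl) (≼-reflexive (≈-sym (identityˡ _))))
  swap-load dec (there _ f)    = ∙-mono ≼-refl (swap-load (dec ∘ cong suc) f)

  -- Item weights are indexed by position, so the argument runs on vectors, comparing loads before
  -- and after the operation.
  feasible-flipSwap : (K : Knapsack M n) → FlipSwap 𝟙 (Feasible M K)
  feasible-flipSwap {n} K =
    (λ { f (inj₁ feasible) → inj₁ (≼-trans (flip-load nonNegative f) feasible)
       ; f (inj₂ refl)     → contradiction (FlipFirst⇒Step f) (Zeros⇒¬Step (replicate⇒Zeros n)) }) ,
    (λ { f (inj₁ feasible) → inj₁ (≼-trans (swap-load decreasing f) feasible)
       ; f (inj₂ refl)     → Sum.[ inj₂ , (λ s → contradiction s (Zeros⇒¬Step (replicate⇒Zeros n))) ]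
                               (SwapFirst⇒Step f) })
    where open Knapsack K

theorem1 : {c ℓ₁ ℓ₂ : Level} (n : ℕ) →
  -- with respect to 1
  ( FlipSwap 𝟙 (ofLength n U)
  × ((k : ℤ) → FlipSwap 𝟙 (ofLength n (λ α → + weight α ℤ.≤ k)))
  × ((γ : List Bool) → FlipSwap 𝟙 (ofLength n (λ α → α ≤ˡ γ)))
  × ((k : ℤ) → FlipSwap 𝟙 (ofLength n (λ α → + inversions 𝟙 α ℤ.≤ k)))
  × ((k : ℤ) → FlipSwap 𝟙 (ofLength n (TranspositionsAtMost k 𝟙)))
  × FlipSwap 𝟙 (ofLength n (λ α → α <ˡ reverse α))
  × FlipSwap 𝟙 (ofLength n (λ α → α ≤ˡ reverse α))
  × FlipSwap 𝟙 (ofLength n (λ α → α <ˡ complementedReversal α))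
  × FlipSwap 𝟙 (ofLength n (λ α → α ≤ˡ complementedReversal α))
  × ((t : ℕ) → FlipSwap 𝟙 (ofLength n (λ α → ¬ IsSubstring (𝟙 ∷ replicate t 𝟘) α)))
  × ((γ : List Bool) → FlipSwap 𝟙 (ofLength n (λ α → ¬ IsPrefix (𝟙 ∷ γ) α)))
  × FlipSwap 𝟙 (ofLength n (PrefixNormal 𝟘))
  × FlipSwap 𝟙 (ofLength n SmallestNecklace)
  × FlipSwap 𝟙 (ofLength n (SmallestNecklace ∩ Aperiodic))
  × FlipSwap 𝟙 (ofLength n (PrefixOf SmallestNecklace))
  × FlipSwap 𝟙 (ofLength n (PseudoNecklace 𝟙))
  × ((k : ℕ) → FlipSwap 𝟙 (ofLength n (PrefixOf (DyckWord 𝟘 k))))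
  × ((M : CommutativePomonoid c ℓ₁ ℓ₂) (K : Knapsack M n) → FlipSwap 𝟙 (Feasible M K))
  ) ×
  -- with respect to 0
  ( FlipSwap 𝟘 (ofLength n U)
  × ((k : ℤ) → FlipSwap 𝟘 (ofLength n (λ α → k ℤ.≤ + weight α)))
  × ((γ : List Bool) → FlipSwap 𝟘 (ofLength n (λ α → γ ≤ˡ α)))
  × ((k : ℤ) → FlipSwap 𝟘 (ofLength n (λ α → + inversions 𝟘 α ℤ.≤ k)))
  × ((k : ℤ) → FlipSwap 𝟘 (ofLength n (TranspositionsAtMost k 𝟘)))
  × FlipSwap 𝟘 (ofLength n (λ α → reverse α <ˡ α))
  × FlipSwap 𝟘 (ofLength n (λ α → reverse α ≤ˡ α))
  × FlipSwap 𝟘 (ofLength n (λ α → complementedReversal α <ˡ α))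
  × FlipSwap 𝟘 (ofLength n (λ α → complementedReversal α ≤ˡ α))
  × ((t : ℕ) → FlipSwap 𝟘 (ofLength n (λ α → ¬ IsSubstring (𝟘 ∷ replicate t 𝟙) α)))
  × ((γ : List Bool) → FlipSwap 𝟘 (ofLength n (λ α → ¬ IsPrefix (𝟘 ∷ γ) α)))
  × FlipSwap 𝟘 (ofLength n (PrefixNormal 𝟙))
  × FlipSwap 𝟘 (ofLength n LargestNecklace)
  × FlipSwap 𝟘 (ofLength n (LargestNecklace ∩ Aperiodic))
  × FlipSwap 𝟘 (ofLength n (PrefixOf LargestNecklace))
  × FlipSwap 𝟘 (ofLength n (PseudoNecklace 𝟘))
  × ((k : ℕ) → FlipSwap 𝟘 (ofLength n (PrefixOf (DyckWord 𝟙 k))))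
  )
theorem1 n =
  ( fs (U-closed 𝟙)
  , (λ k → fs (weight-≤-closed 𝟙 k))
  , (λ γ → fs (downward-closed 𝟙 γ))
  , (λ k → fs (inversions-closed 𝟙 k))
  , (λ k → fs (transpositions-closed 𝟙 k))
  , fs (Below-reverse-closed 𝟙)
  , fs (AtMost-reverse-closed 𝟙)
  , fs (Below-complementedReversal-closed 𝟙)
  , fs (AtMost-complementedReversal-closed 𝟙)
  , (λ t → fs (forbidden-substring-closed 𝟙 t))
  , (λ γ → fs (forbidden-prefix-closed 𝟙 γ))
  , fs (prefixNormal-closed 𝟙)
  , fs (Necklace-closed 𝟙)
  , fs (aperiodicNecklace-closed 𝟙)
  , fs (PrefixOf-closed (Necklace-closed 𝟙))
  , fs (pseudoNecklace-closed 𝟙)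
  , (λ k → fs (leftFactor-closed 𝟙 k))
  , (λ M K → feasible-flipSwap M K)
  ) ,
  ( fs (U-closed 𝟘)
  , (λ k → fs (weight-≥-closed 𝟘 k))
  , (λ γ → fs (downward-closed 𝟘 γ))
  , (λ k → fs (inversions-closed 𝟘 k))
  , (λ k → fs (transpositions-closed 𝟘 k))
  , fs (Below-reverse-closed 𝟘)
  , fs (AtMost-reverse-closed 𝟘)
  , fs (Below-complementedReversal-closed 𝟘)
  , fs (AtMost-complementedReversal-closed 𝟘)
  , (λ t → fs (forbidden-substring-closed 𝟘 t))
  , (λ γ → fs (forbidden-prefix-closed 𝟘 γ))
  , fs (prefixNormal-closed 𝟘)
  , fs (Necklace-closed 𝟘)
  , fs (aperiodicNecklace-closed 𝟘)
  , fs (PrefixOf-closed (Necklace-closed 𝟘))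
  , fs (pseudoNecklace-closed 𝟘)
  , (λ k → fs (leftFactor-closed 𝟘 k))
  )
  where
  fs : ∀ {a ℓ} {P : Pred (List Bool) ℓ} → Closed a P → FlipSwap a (ofLength n P)
  fs closed = Closed⇒FlipSwap closed n
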